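{- For $R=\mathbb{Z}_9$ and for $R=\mathbb{S}_3=\mathbb{F}_3[X]/(X^2)$ there exists a $(57,5)$-blocking set in $\mathrm{PHG}(2,R)$, i.e. a set of $57$ points meeting every line in at least $5$ points. Equivalently (taking the complement), there exists a projective $(60,7)$-arc in $\mathrm{PHG}(2,R)$.
   Context: For a finite chain ring $R$ of length $2$ with residue field $\mathbb{F}_q$ (here $q=3$, $|R|=9$), the projective Hjelmslev plane $\mathrm{PHG}(2,R)$ is the incidence structure whose points are the free rank-$1$ submodules of the right module $R_R^3$, whose lines are the free rank-$2$ submodules of $R_R^3$, with incidence given by inclusion; it has $q^4+q^3+q^2$ points ($117$ here) and each line contains $q^2+q$ points ($12$ here). A projective $(k,n)$-arc is a set of $k$ points meeting every line in at most $n$ points. -}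

module Defs where

open import Algebra.Bundles using (Ring)
open import Algebra.Module.Bundles using (RightModule)
import Algebra.Module.Construct.DirectProduct as DirectProduct
import Algebra.Module.Construct.Idealization as Idealization
import Algebra.Module.Construct.TensorUnit as TensorUnit
import Algebra.Definitions.RawMonoid as RawMonoidSum
open import Data.Fin.Base using (Fin; toℕ)
open import Data.Fin.Properties using (toℕ-injective; toℕ-fromℕ<; toℕ<n)
open import Data.List.Base using (List; length)
import Data.List.Membership.Setoid as ListMembership
import Data.List.Relation.Unary.Unique.Setoid as ListUnique
import Data.Nat.Base as ℕ
open import Data.Nat.Base using (ℕ; NonZero; _≤_)
open import Data.Nat.DivMod using (_%_; _mod_; m%n<n; m<n⇒m%n≡m; m%n%n≡m%n; n%n≡0; %-distribˡ-+; %-distribˡ-*)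
import Data.Nat.Properties as ℕₚ
open import Data.Product.Base using (Σ; Σ-syntax; ∃-syntax; _×_; _,_; proj₁; proj₂)
open import Data.Vec.Functional using (Vector)
open import Function.Base using (_∘_; id)
open import Function.Bundles using (_⇔_)
open import Level using (Level; 0ℓ; _⊔_) renaming (suc to lsuc)
open import Relation.Binary.Bundles using (Setoid)
open import Relation.Binary.Definitions using (_Respects_)
open import Relation.Binary.PropositionalEquality using (_≡_; refl; sym; trans; cong; cong₂; isEquivalence; module ≡-Reasoning)
open import Relation.Nullary.Decidable using (¬?)
open import Relation.Nullary.Negation using (¬_)
open import Relation.Unary using (Pred; Decidable)

module IntegersMod (n : ℕ) .{{_ : NonZero n}} where

  infixl 6 _+_
  infixl 7 _*_

  [_] : ℕ → Fin n
  [ a ] = a mod n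

  _+_ _*_ : Fin n → Fin n → Fin n
  i + j = [ toℕ i ℕ.+ toℕ j ]
  i * j = [ toℕ i ℕ.* toℕ j ]

  -_ : Fin n → Fin n
  - i = [ n ℕ.∸ toℕ i ]

  toℕ-[] : ∀ a → toℕ [ a ] ≡ a % n
  toℕ-[] a = toℕ-fromℕ< (m%n<n a n)

  []-cong-% : ∀ {a b} → a % n ≡ b % n → [ a ] ≡ [ b ]
  []-cong-% {a} {b} eq = toℕ-injective (trans (toℕ-[] a) (trans eq (sym (toℕ-[] b))))

  [toℕ] : ∀ i → [ toℕ i ] ≡ i
  [toℕ] i = toℕ-injective (trans (toℕ-[] (toℕ i)) (m<n⇒m%n≡m (toℕ<n i)))

  []-+ : ∀ a b → [ a ] + [ b ] ≡ [ a ℕ.+ b ]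
  []-+ a b = []-cong-%
    (trans (cong₂ (λ x y → (x ℕ.+ y) % n) (toℕ-[] a) (toℕ-[] b)) (sym (%-distribˡ-+ a b n)))

  []-* : ∀ a b → [ a ] * [ b ] ≡ [ a ℕ.* b ]
  []-* a b = []-cong-%
    (trans (cong₂ (λ x y → (x ℕ.* y) % n) (toℕ-[] a) (toℕ-[] b)) (sym (%-distribˡ-* a b n)))

  +-[]ʳ : ∀ i b → i + [ b ] ≡ [ toℕ i ℕ.+ b ]
  +-[]ʳ i b = trans (cong (_+ [ b ]) (sym ([toℕ] i))) ([]-+ (toℕ i) b)

  *-[]ʳ : ∀ i b → i * [ b ] ≡ [ toℕ i ℕ.* b ]
  *-[]ʳ i b = trans (cong (_* [ b ]) (sym ([toℕ] i))) ([]-* (toℕ i) b)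

  +-comm : ∀ i j → i + j ≡ j + i
  +-comm i j = cong [_] (ℕₚ.+-comm (toℕ i) (toℕ j))

  *-comm : ∀ i j → i * j ≡ j * i
  *-comm i j = cong [_] (ℕₚ.*-comm (toℕ i) (toℕ j))

  +-assoc : ∀ i j k → (i + j) + k ≡ i + (j + k)
  +-assoc i j k = begin
    (i + j) + k                         ≡⟨ +-comm (i + j) k ⟩
    k + (i + j)                         ≡⟨ +-[]ʳ k _ ⟩
    [ toℕ k ℕ.+ (toℕ i ℕ.+ toℕ j) ]     ≡⟨ cong [_] (ℕₚ.+-comm (toℕ k) _) ⟩
    [ (toℕ i ℕ.+ toℕ j) ℕ.+ toℕ k ]     ≡⟨ cong [_] (ℕₚ.+-assoc (toℕ i) _ _) ⟩
    [ toℕ i ℕ.+ (toℕ j ℕ.+ toℕ k) ]     ≡⟨ +-[]ʳ i _ ⟨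
    i + (j + k)                         ∎
    where open ≡-Reasoning

  *-assoc : ∀ i j k → (i * j) * k ≡ i * (j * k)
  *-assoc i j k = begin
    (i * j) * k                         ≡⟨ *-comm (i * j) k ⟩
    k * (i * j)                         ≡⟨ *-[]ʳ k _ ⟩
    [ toℕ k ℕ.* (toℕ i ℕ.* toℕ j) ]     ≡⟨ cong [_] (ℕₚ.*-comm (toℕ k) _) ⟩
    [ (toℕ i ℕ.* toℕ j) ℕ.* toℕ k ]     ≡⟨ cong [_] (ℕₚ.*-assoc (toℕ i) _ _) ⟩
    [ toℕ i ℕ.* (toℕ j ℕ.* toℕ k) ]     ≡⟨ *-[]ʳ i _ ⟨
    i * (j * k)                         ∎
    where open ≡-Reasoning

  +-identityʳ : ∀ i → i + [ 0 ] ≡ i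
  +-identityʳ i = trans (+-[]ʳ i 0) (trans (cong [_] (ℕₚ.+-identityʳ (toℕ i))) ([toℕ] i))

  *-identityʳ : ∀ i → i * [ 1 ] ≡ i
  *-identityʳ i = trans (*-[]ʳ i 1) (trans (cong [_] (ℕₚ.*-identityʳ (toℕ i))) ([toℕ] i))

  -‿inverseʳ : ∀ i → i + (- i) ≡ [ 0 ]
  -‿inverseʳ i = begin
    i + (- i)                           ≡⟨ +-[]ʳ i _ ⟩
    [ toℕ i ℕ.+ (n ℕ.∸ toℕ i) ]         ≡⟨ cong [_] (ℕₚ.m+[n∸m]≡n (ℕₚ.<⇒≤ (toℕ<n i))) ⟩
    [ n ]                               ≡⟨ []-cong-% (trans (n%n≡0 n) (sym (m<n⇒m%n≡m (ℕ.>-nonZero⁻¹ n)))) ⟩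
    [ 0 ]                               ∎
    where open ≡-Reasoning

  distribˡ : ∀ i j k → i * (j + k) ≡ i * j + i * k
  distribˡ i j k = begin
    i * (j + k)                                   ≡⟨ *-[]ʳ i _ ⟩
    [ toℕ i ℕ.* (toℕ j ℕ.+ toℕ k) ]               ≡⟨ cong [_] (ℕₚ.*-distribˡ-+ (toℕ i) _ _) ⟩
    [ toℕ i ℕ.* toℕ j ℕ.+ toℕ i ℕ.* toℕ k ]       ≡⟨ []-+ _ _ ⟨
    i * j + i * k                                 ∎
    where open ≡-Reasoning

  distribʳ : ∀ i j k → (j + k) * i ≡ j * i + k * i
  distribʳ i j k =
    trans (*-comm (j + k) i) (trans (distribˡ i j k) (cong₂ _+_ (*-comm i j) (*-comm i k)))

  ring : Ring 0ℓ 0ℓ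
  ring = record
    { Carrier = Fin n
    ; _≈_     = _≡_
    ; _+_     = _+_
    ; _*_     = _*_
    ; -_      = -_
    ; 0#      = [ 0 ]
    ; 1#      = [ 1 ]
    ; isRing  = record
      { +-isAbelianGroup = record
        { isGroup = record
          { isMonoid = record
            { isSemigroup = record
              { isMagma = record { isEquivalence = isEquivalence ; ∙-cong = cong₂ _+_ }
              ; assoc   = +-assoc
              }
            ; identity = (λ i → trans (+-comm [ 0 ] i) (+-identityʳ i)) , +-identityʳ
            }
          ; inverse = (λ i → trans (+-comm (- i) i) (-‿inverseʳ i)) , -‿inverseʳ
          ; ⁻¹-cong = cong -_
          }
        ; comm = +-comm
        }
      ; *-cong     = cong₂ _*_
      ; *-assoc    = *-assoc
      ; *-identity = (λ i → trans (*-comm [ 1 ] i) (*-identityʳ i)) , *-identityʳ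
      ; distrib    = distribˡ , distribʳ
      }
    }

ℤ₉ : Ring 0ℓ 0ℓ
ℤ₉ = IntegersMod.ring 9

𝔽₃ : Ring 0ℓ 0ℓ
𝔽₃ = IntegersMod.ring 3

-- 𝔽₃[X]/(X²): the pair (a , b) is the residue class of a + bX, and the
-- product in the idealization 𝔽₃ ⋉ 𝔽₃ is (a , b)(c , d) = (ac , ad + bc).
𝕊₃ : Ring 0ℓ 0ℓ
𝕊₃ = Idealization.ringᴺ 𝔽₃ TensorUnit.bimodule

module Submodules {c ℓ m ℓm : Level} {R : Ring c ℓ} (M : RightModule R m ℓm) where

  open Ring R using (Carrier; _≈_; 0#)
  open RightModule M
  open RawMonoidSum +ᴹ-rawMonoid using (sum)

  private
    s : Level
    s = c ⊔ ℓ ⊔ m ⊔ ℓm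

  record Submodule : Set (lsuc s) where
    field
      Member    : Pred Carrierᴹ s
      resp      : Member Respects _≈ᴹ_
      0-closed  : Member 0ᴹ
      +-closed  : ∀ {x y} → Member x → Member y → Member (x +ᴹ y)
      *ᵣ-closed : ∀ {x} r → Member x → Member (x *ᵣ r)

  open Submodule public

  infix 4 _⊆_ _≅_

  _⊆_ : Submodule → Submodule → Set s
  N ⊆ N′ = ∀ x → Member N x → Member N′ x

  _≅_ : Submodule → Submodule → Set s
  N ≅ N′ = (N ⊆ N′) × (N′ ⊆ N)

  linearCombination : ∀ {n} → Vector Carrierᴹ n → Vector Carrier n → Carrierᴹ
  linearCombination b r = sum (λ i → b i *ᵣ r i)

  record IsBasis (N : Submodule) {n : ℕ} (b : Vector Carrierᴹ n) : Set s where
    field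
      members     : ∀ i → Member N (b i)
      independent : ∀ r → linearCombination b r ≈ᴹ 0ᴹ → ∀ i → r i ≈ 0#
      spanning    : ∀ {x} → Member N x → ∃[ r ] x ≈ᴹ linearCombination b r

  IsFreeOfRank : ℕ → Submodule → Set s
  IsFreeOfRank n N = Σ[ b ∈ Vector Carrierᴹ n ] IsBasis N b

  FreeSubmodule : ℕ → Set (lsuc s)
  FreeSubmodule n = Σ Submodule (IsFreeOfRank n)

  freeSubmoduleSetoid : ℕ → Setoid (lsuc s) s
  freeSubmoduleSetoid n = record
    { Carrier       = FreeSubmodule n
    ; _≈_           = λ P Q → proj₁ P ≅ proj₁ Q
    ; isEquivalence = record
      { refl  = (λ _ → id) , (λ _ → id)
      ; sym   = λ (p , q) → q , p
      ; trans = λ (p , q) (p′ , q′) → (λ x → p′ x ∘ p x) , (λ x → q x ∘ q′ x)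
      }
    }

module Cardinality {a ℓ : Level} (S : Setoid a ℓ) where

  open Setoid S using (Carrier)
  open ListMembership S using (_∈_)
  open ListUnique S using (Unique)

  HasCardinality : ∀ {p} → Pred Carrier p → ℕ → Set (a ⊔ ℓ ⊔ p)
  HasCardinality P k =
    Σ[ xs ∈ List Carrier ] Unique xs × (∀ x → P x ⇔ x ∈ xs) × length xs ≡ k

module PHG {c ℓ : Level} (R : Ring c ℓ) where

  R³ : RightModule R c ℓ
  R³ = DirectProduct.rightModule R¹ (DirectProduct.rightModule R¹ R¹)
    where
    R¹ : RightModule R c ℓ
    R¹ = TensorUnit.rightModule

  open Submodules R³

  Point : Set (lsuc (c ⊔ ℓ))
  Point = FreeSubmodule 1

  Line : Set (lsuc (c ⊔ ℓ))
  Line = FreeSubmodule 2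

  pointSetoid : Setoid (lsuc (c ⊔ ℓ)) (c ⊔ ℓ)
  pointSetoid = freeSubmoduleSetoid 1

  open Setoid pointSetoid public using () renaming (_≈_ to _≈ᴾ_)
  open Cardinality pointSetoid public

  infix 4 _on_

  _on_ : Point → Line → Set (c ⊔ ℓ)
  (P , _) on (L , _) = P ⊆ L

  -- A set of points of the plane. Membership is required to be decidable
  -- because classically every subset is; without this, a set could not be
  -- recovered from its complement.
  record PointSet : Set (lsuc (lsuc (c ⊔ ℓ))) where
    field
      _∋_      : Pred Point (lsuc (c ⊔ ℓ))
      respects : _∋_ Respects _≈ᴾ_
      _∋?_     : Decidable _∋_

  open PointSet public

  ∁ : PointSet → PointSet
  ∁ B = record
    { _∋_      = λ P → ¬ (B ∋ P)
    ; respects = λ {P} {Q} P≈Q P∉B Q∈B → P∉B (respects B (Setoid.sym pointSetoid {P} {Q} P≈Q) Q∈B)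
    ; _∋?_     = λ P → ¬? (B ∋? P)
    }

  _∩_ : PointSet → Line → Pred Point (lsuc (c ⊔ ℓ))
  (B ∩ L) P = (B ∋ P) × (P on L)

  IsBlockingSet : ℕ → ℕ → PointSet → Set (lsuc (c ⊔ ℓ))
  IsBlockingSet k n B =
    HasCardinality (B ∋_) k ×
    (∀ L → ∃[ m ] HasCardinality (B ∩ L) m × n ≤ m)

  IsProjectiveArc : ℕ → ℕ → PointSet → Set (lsuc (c ⊔ ℓ))
  IsProjectiveArc k n K =
    HasCardinality (K ∋_) k ×
    (∀ L → ∃[ m ] HasCardinality (K ∩ L) m × m ≤ n)

{-# OPTIONS --safe #-}
module Submission where

-- Over a finite commutative local ring every point is spanned by exactly one
-- vector of the form (1 , a , b), (p , 1 , b) or (p , q , 1) with p and q in the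
-- maximal ideal. The cross product of the two basis vectors of a line is
-- unimodular, so every line is the kernel x ↦ f · x = 0 of a linear form f, which
-- may be rescaled to one of the same 117 vectors. Hence the plane has 117 points,
-- each line has 12 points, and whether a given set of points is a blocking set
-- becomes a finite computation with 117 × 117 scalar products. Complements trade
-- 57 for 117 − 57 = 60 and "at least 5 of 12" for "at most 7 of 12".

open import Defs
open import Algebra.Bundles using (CommutativeRing; Ring)
open import Algebra.Module.Bundles using (RightModule)
import Algebra.Properties.Ring as RingProperties
import Algebra.Properties.Semiring.Mult as SemiringMult
import Algebra.Solver.Ring as RingSolver
open import Algebra.Solver.Ring.AlmostCommutativeRing using (fromCommutativeRing; _-Raw-AlmostCommutative⟶_)
open import Data.Fin.Base using (Fin; zero; suc)
import Data.Fin.Properties as Finₚ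
import Data.Integer.Base as ℤ
open import Data.Integer.Base using (ℤ; +_; -[1+_])
import Data.Integer.Properties as ℤₚ
open import Data.List.Base using (List; []; _∷_; _++_; allFin; cartesianProduct; cartesianProductWith; filter; length; lookup; map)
import Data.List.Membership.Propositional.Properties as Membershipₚ≡
import Data.List.Membership.Setoid as Membership
import Data.List.Membership.Setoid.Properties as Membershipₚ
open import Data.List.Properties using (length-map)
open import Data.List.Relation.Unary.All as All using (All)
import Data.List.Relation.Unary.All.Properties as Allₚ
open import Data.List.Relation.Unary.AllPairs using (_∷_)
import Data.List.Relation.Unary.AllPairs.Properties as AllPairsₚ
open import Data.List.Relation.Unary.Any as Any using (Any)
import Data.List.Relation.Unary.Any.Properties as Anyₚ
import Data.List.Relation.Unary.Unique.Propositional.Properties as Uniqueₚ≡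
import Data.List.Relation.Unary.Unique.Setoid as UniqueSetoid
import Data.List.Relation.Unary.Unique.Setoid.Properties as Uniqueₚ
import Data.Maybe.Base as Maybe
import Data.Nat.Base as ℕ
open import Data.Nat.Base using (ℕ; zero; suc; _≤_)
open import Data.Nat.DivMod using (_/_)
import Data.Nat.Properties as ℕₚ
open import Data.Product.Base using (Σ; _×_; _,_; ∃-syntax; proj₁; proj₂; swap)
open import Data.Product.Relation.Binary.Pointwise.NonDependent using (×-decidable)
import Data.Sign.Base as Sign
open import Data.Sum.Base using (_⊎_; inj₁; inj₂; [_,_]′)
open import Data.Unit.Base using (tt)
import Data.Vec.Functional as Vector
open import Function.Base using (_∘_; const; id)
open import Function.Bundles using (_⇔_; mk⇔; Equivalence)
open import Level using (Level; 0ℓ; _⊔_)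
open import Relation.Binary.Bundles using (Setoid)
import Relation.Binary.Construct.On as On
open import Relation.Binary.Definitions using (Decidable; _Respects_)
open import Relation.Binary.PropositionalEquality as ≡ using (_≡_)
import Relation.Binary.Reasoning.Setoid as SetoidReasoning
open import Relation.Nullary.Decidable as Dec using (Dec; yes; no; ¬?; _×-dec_; _⊎-dec_; dec⇒maybe; from-yes)
open import Relation.Nullary.Negation using (¬_; contradiction)
import Relation.Unary as Unary
open import Relation.Unary using (Pred; U)

private
  variable
    a a′ c ℓ p q : Level

-- The ring solver with integer coefficients: with coefficients in an abstract ring
-- it could not detect cancellation.
module IntegerCoefficients (R : CommutativeRing c ℓ) where

  open CommutativeRing R
  open RingProperties ring
  open SemiringMult semiring renaming (_×_ to _⊗_)
  open SetoidReasoning setoid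

  ι : ℤ → Carrier
  ι (+ n)    = n ⊗ 1#
  ι -[1+ n ] = - (suc n ⊗ 1#)

  ι-⊖ : ∀ m n → ι (m ℤ.⊖ n) ≈ m ⊗ 1# - n ⊗ 1#
  ι-⊖ m       zero    = sym (trans (+-congˡ -0#≈0#) (+-identityʳ _))
  ι-⊖ zero    (suc n) = sym (+-identityˡ _)
  ι-⊖ (suc m) (suc n) = begin
    ι (suc m ℤ.⊖ suc n)                       ≡⟨ ≡.cong ι (ℤₚ.[1+m]⊖[1+n]≡m⊖n m n) ⟩
    ι (m ℤ.⊖ n)                               ≈⟨ ι-⊖ m n ⟩
    -- The zero 1 - 1 is inserted so that both multiples gain the summand their successors call for.
    m ⊗ 1# - n ⊗ 1#                           ≈⟨ +-congʳ (trans (+-congˡ (-‿inverseʳ 1#)) (+-identityʳ _)) ⟨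
    (m ⊗ 1# + (1# - 1#)) - n ⊗ 1#             ≈⟨ +-congʳ (+-assoc _ _ _) ⟨
    ((m ⊗ 1# + 1#) - 1#) - n ⊗ 1#             ≈⟨ +-assoc _ _ _ ⟩
    (m ⊗ 1# + 1#) + (- 1# - n ⊗ 1#)           ≈⟨ +-cong (+-comm _ _) (-‿+-comm _ _) ⟩
    (1# + m ⊗ 1#) - (1# + n ⊗ 1#)             ∎

  ι-+ : ∀ i j → ι (i ℤ.+ j) ≈ ι i + ι j
  ι-+ (+ m)    (+ n)    = ×-homo-+ 1# m n
  ι-+ (+ m)    -[1+ n ] = ι-⊖ m (suc n)
  ι-+ -[1+ m ] (+ n)    = trans (ι-⊖ n (suc m)) (+-comm _ _)
  ι-+ -[1+ m ] -[1+ n ] = begin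
    - (suc (suc (m ℕ.+ n)) ⊗ 1#)      ≡⟨ ≡.cong (λ k → - (suc k ⊗ 1#)) (ℕₚ.+-suc m n) ⟨
    - ((suc m ℕ.+ suc n) ⊗ 1#)        ≈⟨ -‿cong (×-homo-+ 1# (suc m) (suc n)) ⟩
    - (suc m ⊗ 1# + suc n ⊗ 1#)       ≈⟨ -‿+-comm _ _ ⟨
    - (suc m ⊗ 1#) - suc n ⊗ 1#       ∎

  -- Integer multiplication is defined through `ℤ._◃_`, which is stuck on an open natural number; a
  -- case split is needed for each sign before `ι` computes.
  ι-+◃ : ∀ n → ι (Sign.+ ℤ.◃ n) ≈ n ⊗ 1#
  ι-+◃ zero    = refl
  ι-+◃ (suc n) = refl

  ι--◃ : ∀ n → ι (Sign.- ℤ.◃ n) ≈ - (n ⊗ 1#)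
  ι--◃ zero    = sym -0#≈0#
  ι--◃ (suc n) = refl

  ι-* : ∀ i j → ι (i ℤ.* j) ≈ ι i * ι j
  ι-* (+ m)    (+ n)    = trans (ι-+◃ (m ℕ.* n)) (×1-homo-* m n)
  ι-* (+ m)    -[1+ n ] =
    trans (ι--◃ (m ℕ.* suc n)) (trans (-‿cong (×1-homo-* m (suc n))) (-‿distribʳ-* _ _))
  ι-* -[1+ m ] (+ n)    =
    trans (ι--◃ (suc m ℕ.* n)) (trans (-‿cong (×1-homo-* (suc m) n)) (-‿distribˡ-* _ _))
  ι-* -[1+ m ] -[1+ n ] = begin
    (suc m ℕ.* suc n) ⊗ 1#                ≈⟨ ×1-homo-* (suc m) (suc n) ⟩
    suc m ⊗ 1# * (suc n ⊗ 1#)             ≈⟨ -‿involutive _ ⟨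
    - - (suc m ⊗ 1# * (suc n ⊗ 1#))       ≈⟨ -‿cong (-‿distribʳ-* _ _) ⟩
    - (suc m ⊗ 1# * - (suc n ⊗ 1#))       ≈⟨ -‿distribˡ-* _ _ ⟩
    - (suc m ⊗ 1#) * - (suc n ⊗ 1#)       ∎

  ι-- : ∀ i → ι (ℤ.- i) ≈ - ι i
  ι-- (+ zero)    = sym -0#≈0#
  ι-- (+ (suc n)) = refl
  ι-- -[1+ n ]    = sym (-‿involutive _)

  morphism : ℤ.+-*-rawRing -Raw-AlmostCommutative⟶ fromCommutativeRing R
  morphism = record
    { ⟦_⟧    = ι
    ; +-homo = ι-+
    ; *-homo = ι-*
    ; -‿homo = ι--
    ; 0-homo = refl
    ; 1-homo = +-identityʳ 1#
    }

  open RingSolver ℤ.+-*-rawRing (fromCommutativeRing R) morphism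
    (λ i j → Maybe.map (reflexive ∘ ≡.cong ι) (dec⇒maybe (i ℤₚ.≟ j))) public
    using (Polynomial; solve; _:=_; _:+_; _:*_; _:-_; :-_; con)

-- Counting up to the equality of a setoid.

-- Serves to replace a count of points by a count of vectors: the two tests may decide in different
-- ways as long as the predicates agree, so the second can be one that evaluates well.
length-filter-map : ∀ {A : Set a} {B : Set a′} {P : Pred B p} {Q : Pred A q}
  (P? : Unary.Decidable P) (Q? : Unary.Decidable Q) (f : A → B) →
  (∀ x → P (f x) ⇔ Q x) → ∀ xs → length (filter P? (map f xs)) ≡ length (filter Q? xs)
length-filter-map P? Q? f P⇔Q []       = ≡.refl
length-filter-map P? Q? f P⇔Q (x ∷ xs) with P? (f x) | Q? x
... | yes _  | yes _  = ≡.cong suc (length-filter-map P? Q? f P⇔Q xs)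
... | no  _  | no  _  = length-filter-map P? Q? f P⇔Q xs
... | yes Px | no ¬Qx = contradiction (Equivalence.to (P⇔Q x) Px) ¬Qx
... | no ¬Px | yes Qx = contradiction (Equivalence.from (P⇔Q x) Qx) ¬Px

module _ {S : Setoid a ℓ} where

  open Setoid S
  open Cardinality S
  open Membership S using (_∈_)
  open UniqueSetoid S using (Unique)

  private
    variable
      P : Pred Carrier p
      Q : Pred Carrier q

  lookup-injective : ∀ {xs} → Unique xs → ∀ i j → lookup xs i ≈ lookup xs j → i ≡ j
  lookup-injective (_  ∷ _)   zero    zero    _  = ≡.refl
  lookup-injective (x≉ ∷ _)   zero    (suc j) eq =
    contradiction eq (All.lookup x≉ (Membershipₚ≡.∈-lookup j))
  lookup-injective (x≉ ∷ _)   (suc i) zero    eq =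
    contradiction (sym eq) (All.lookup x≉ (Membershipₚ≡.∈-lookup i))
  lookup-injective (_  ∷ xs!) (suc i) (suc j) eq = ≡.cong suc (lookup-injective xs! i j eq)

  -- Pigeonhole: send each index of `xs` to the position in `ys` of its entry. Equal positions force
  -- equal entries, hence equal indices since `xs` has no repetitions.
  unique⊆⇒length≤ : ∀ {xs ys} → Unique xs → (∀ x → x ∈ xs → x ∈ ys) → length xs ≤ length ys
  unique⊆⇒length≤ {xs} {ys} xs! xs⊆ys = Finₚ.injective⇒≤ {f = λ i → Any.index (position i)} λ {i} {j} eq →
    lookup-injective xs! i j (Membershipₚ.index-injective S (position i) (position j) eq)
    where
    position : ∀ i → lookup xs i ∈ ys
    position i = xs⊆ys _ (Membershipₚ.∈-lookup S xs i)

  HasCardinality-unique : ∀ {j k} → HasCardinality P j → HasCardinality P k → j ≡ k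
  HasCardinality-unique (xs , xs! , P⇔xs , ≡.refl) (ys , ys! , P⇔ys , ≡.refl) = ℕₚ.≤-antisym
    (unique⊆⇒length≤ xs! λ x → to (P⇔ys x) ∘ from (P⇔xs x))
    (unique⊆⇒length≤ ys! λ x → to (P⇔xs x) ∘ from (P⇔ys x))
    where open Equivalence

  HasCardinality-resp : (∀ x → P x ⇔ Q x) → ∀ {k} → HasCardinality P k → HasCardinality Q k
  HasCardinality-resp P⇔Q (xs , xs! , P⇔xs , eq) =
    xs , xs! , (λ x → mk⇔ (to (P⇔xs x) ∘ from (P⇔Q x)) (to (P⇔Q x) ∘ from (P⇔xs x))) , eq
    where open Equivalence

  HasCardinality-filter : (P? : Unary.Decidable P) → P Respects _≈_ →
    ∀ {k} (|Q|≡k : HasCardinality Q k) →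
    HasCardinality (λ x → P x × Q x) (length (filter P? (proj₁ |Q|≡k)))
  HasCardinality-filter P? resp (xs , xs! , Q⇔xs , _) =
    filter P? xs ,
    Uniqueₚ.filter⁺ S P? xs! ,
    (λ x → mk⇔
      (λ (Px , Qx) → Membershipₚ.∈-filter⁺ S P? resp (to (Q⇔xs x) Qx) Px)
      (λ x∈ → let x∈xs , Px = Membershipₚ.∈-filter⁻ S P? resp x∈ in Px , from (Q⇔xs x) x∈xs)) ,
    ≡.refl
    where open Equivalence

  length-filter+filter-¬ : (P? : Unary.Decidable P) → ∀ xs →
    length (filter P? xs) ℕ.+ length (filter (¬? ∘ P?) xs) ≡ length xs
  length-filter+filter-¬ P? []       = ≡.refl
  length-filter+filter-¬ P? (x ∷ xs) with P? x
  ... | yes _ = ≡.cong suc (length-filter+filter-¬ P? xs)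
  ... | no  _ = ≡.trans (ℕₚ.+-suc _ _) (≡.cong suc (length-filter+filter-¬ P? xs))

  -- Filtering one enumeration of `Q` by `P` and by its negation cuts it into two lists whose
  -- lengths add up; this ties the count of a set to that of its complement.
  HasCardinality-split : Unary.Decidable P → P Respects _≈_ → ∀ {n} → HasCardinality Q n →
    ∃[ j ] ∃[ k ] HasCardinality (λ x → P x × Q x) j ×
                  HasCardinality (λ x → ¬ P x × Q x) k × j ℕ.+ k ≡ n
  HasCardinality-split P? resp |Q|≡n@(xs , _ , _ , eq) =
    _ , _ , HasCardinality-filter P? resp |Q|≡n ,
    HasCardinality-filter (¬? ∘ P?) (λ x≈y ¬Px → ¬Px ∘ resp (sym x≈y)) |Q|≡n ,
    ≡.trans (length-filter+filter-¬ P? xs) eq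

m+n≡o+p∧o≤m⇒n≤p : ∀ {m n o p} → m ℕ.+ n ≡ o ℕ.+ p → o ≤ m → n ≤ p
m+n≡o+p∧o≤m⇒n≤p {m} {n} {o} {p} eq o≤m =
  ℕₚ.+-cancelˡ-≤ o n p (ℕₚ.≤-trans (ℕₚ.+-monoˡ-≤ n o≤m) (ℕₚ.≤-reflexive eq))

-- Exchanging blocking sets and arcs by complementation.

module _ (R : Ring c ℓ) where

  open PHG R

  -- Split the whole plane and each line into the part in `B` and the part outside. Cardinalities
  -- are unique, so one part has the size given by the hypothesis, and the fixed total determines or
  -- bounds the other.
  blocking⇔arc : ∀ {k k′ n n′} →
    HasCardinality {p = 0ℓ} U (k ℕ.+ k′) → (∀ L → HasCardinality (_on L) (n ℕ.+ n′)) →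
    ∀ B → IsBlockingSet k n B ⇔ IsProjectiveArc k′ n′ (∁ B)
  blocking⇔arc {k} {k′} {n} {n′} |points| |line| B = mk⇔
    (λ (|B| , meetB) →
      let j , j′ , |B|′ , |∁B| , j+j′≡k+k′ = split |points|
          j≡k = unique (drop-U |B|′) |B|
      in ≡.subst (HasCardinality (∁ B ∋_))
           (ℕₚ.+-cancelˡ-≡ k j′ k′ (≡.trans (≡.cong (ℕ._+ j′) (≡.sym j≡k)) j+j′≡k+k′))
           (drop-U |∁B|) ,
         λ L → let m , |B∩L| , n≤m = meetB L
                   i , i′ , |B∩L|′ , |∁B∩L| , i+i′≡n+n′ = split (|line| L)
                   n≤i = ℕₚ.≤-trans n≤m (ℕₚ.≤-reflexive (unique |B∩L| |B∩L|′))
               in i′ , |∁B∩L| , m+n≡o+p∧o≤m⇒n≤p i+i′≡n+n′ n≤i)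
    (λ (|∁B| , meet∁B) →
      let j , j′ , |B| , |∁B|′ , j+j′≡k+k′ = split |points|
          j′≡k′ = unique (drop-U |∁B|′) |∁B|
      in ≡.subst (HasCardinality (B ∋_))
           (ℕₚ.+-cancelʳ-≡ k′ j k (≡.trans (≡.cong (j ℕ.+_) (≡.sym j′≡k′)) j+j′≡k+k′))
           (drop-U |B|) ,
         λ L → let m , |∁B∩L| , m≤n′ = meet∁B L
                   i , i′ , |B∩L| , |∁B∩L|′ , i+i′≡n+n′ = split (|line| L)
                   i′≤n′ = ℕₚ.≤-trans (ℕₚ.≤-reflexive (unique |∁B∩L|′ |∁B∩L|)) m≤n′
                   -- The summands are exchanged because here the known bound concerns the part
                   -- outside `B`.
                   n′+n≡i′+i = ≡.trans (ℕₚ.+-comm n′ n) (≡.trans (≡.sym i+i′≡n+n′) (ℕₚ.+-comm i i′))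
               in i , |B∩L| , m+n≡o+p∧o≤m⇒n≤p n′+n≡i′+i i′≤n′)
    where
    split : ∀ {q} {Q : Pred Point q} {m} → HasCardinality Q m → _
    split = HasCardinality-split {S = pointSetoid} (B ∋?_) (λ {P} {P′} → respects B {P} {P′})

    unique : ∀ {q} {Q : Pred Point q} {i j} → HasCardinality Q i → HasCardinality Q j → i ≡ j
    unique = HasCardinality-unique {S = pointSetoid}

    drop-U : ∀ {q} {Q : Pred Point q} {m} → HasCardinality (λ P → Q P × U P) m → HasCardinality Q m
    drop-U = HasCardinality-resp {S = pointSetoid} λ _ → mk⇔ proj₁ (_, tt)

-- In a finite local ring π can be any nonzero socle element, as the socle is
-- annihilated by the maximal ideal; here π is 3 in ℤ₉ and X in 𝕊₃.
record FiniteLocalRing (R : Ring c ℓ) : Set (c ⊔ ℓ) where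
  open Ring R hiding (zero)
  open Membership setoid using (_∈_)
  open UniqueSetoid setoid using (Unique)

  infix 4 _≟_

  field
    *-comm       : ∀ x y → x * y ≈ y * x
    _≟_          : Decidable _≈_
    elements     : List Carrier
    elements!    : Unique elements
    ∈-elements   : ∀ x → x ∈ elements
    π            : Carrier
    π≉0          : ¬ (π ≈ 0#)
    unit⊎torsion : ∀ x → (∃[ u ] x * u ≈ 1#) ⊎ x * π ≈ 0#

module HjelmslevPlane {R : Ring c ℓ} (F : FiniteLocalRing R) where

  open Ring R hiding (zero)
  open FiniteLocalRing F
  open PHG R
  open Submodules R³
  open RightModule R³
    using
    ( _≈ᴹ_; _+ᴹ_; _*ᵣ_; 0ᴹ; ≈ᴹ-refl; ≈ᴹ-sym; ≈ᴹ-trans; ≈ᴹ-setoid; +ᴹ-cong; +ᴹ-comm; +ᴹ-identityʳ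
    ; *ᵣ-cong; *ᵣ-zeroʳ; *ᵣ-identityʳ; *ᵣ-assoc; *ᵣ-distribˡ; *ᵣ-distribʳ
    )
    renaming (Carrierᴹ to V)

  open RingProperties R using (-0#≈0#)

  commutativeRing : CommutativeRing c ℓ
  commutativeRing = record { isCommutativeRing = record { isRing = isRing ; *-comm = *-comm } }

  open IntegerCoefficients commutativeRing using (Polynomial; solve; _:=_; _:+_; _:*_; _:-_; :-_; con)

  -- Scalar and cross products of vectors.

  infix  8 _·_
  infixl 8 _⨯_

  _·_ : V → V → Carrier
  (x , y , z) · (x′ , y′ , z′) = x * x′ + (y * y′ + z * z′)

  _⨯_ : V → V → V
  (x , y , z) ⨯ (x′ , y′ , z′) = y * z′ - z * y′ , z * x′ - x * z′ , x * y′ - y * x′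

  private
    Polynomials : ℕ → Set
    Polynomials n = Polynomial n × Polynomial n × Polynomial n

    infix  9 _:·_
    infixl 9 _:⨯_

    -- Both products are repeated on solver polynomials so that the goals below read like the
    -- identities they prove.
    _:·_ : ∀ {n} → Polynomials n → Polynomials n → Polynomial n
    (x , y , z) :· (x′ , y′ , z′) = x :* x′ :+ (y :* y′ :+ z :* z′)

    _:⨯_ : ∀ {n} → Polynomials n → Polynomials n → Polynomials n
    (x , y , z) :⨯ (x′ , y′ , z′) = y :* z′ :- z :* y′ , z :* x′ :- x :* z′ , x :* y′ :- y :* x′

  ·-cong : ∀ {u u′ v v′} → u ≈ᴹ u′ → v ≈ᴹ v′ → u · v ≈ u′ · v′
  ·-cong (p , q , r) (p′ , q′ , r′) = +-cong (*-cong p p′) (+-cong (*-cong q q′) (*-cong r r′))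

  ⨯-congʳ : ∀ {u u′} v → u ≈ᴹ u′ → u ⨯ v ≈ᴹ u′ ⨯ v
  ⨯-congʳ v (p , q , r) =
    +-cong (*-congʳ q) (-‿cong (*-congʳ r)) ,
    +-cong (*-congʳ r) (-‿cong (*-congʳ p)) ,
    +-cong (*-congʳ p) (-‿cong (*-congʳ q))

  ·-comm : ∀ u v → u · v ≈ v · u
  ·-comm (x , y , z) (x′ , y′ , z′) =
    +-cong (*-comm x x′) (+-cong (*-comm y y′) (*-comm z z′))

  ·-zeroʳ : ∀ v → v · 0ᴹ ≈ 0#
  ·-zeroʳ (x , y , z) = solve 3 (λ x y z → (x , y , z) :· (con (+ 0) , con (+ 0) , con (+ 0)) := con (+ 0))
    refl x y z

  ·-*ᵣ : ∀ u v r → u · (v *ᵣ r) ≈ (u · v) * r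
  ·-*ᵣ (x , y , z) (x′ , y′ , z′) r = solve 7
    (λ x y z x′ y′ z′ r → (x , y , z) :· (x′ :* r , y′ :* r , z′ :* r)
                       := (x , y , z) :· (x′ , y′ , z′) :* r)
    refl x y z x′ y′ z′ r

  ·-+ᴹ : ∀ u v w → u · (v +ᴹ w) ≈ u · v + u · w
  ·-+ᴹ (x , y , z) (x′ , y′ , z′) (x″ , y″ , z″) = solve 9
    (λ x y z x′ y′ z′ x″ y″ z″ →
      (x , y , z) :· (x′ :+ x″ , y′ :+ y″ , z′ :+ z″)
      := (x , y , z) :· (x′ , y′ , z′) :+ (x , y , z) :· (x″ , y″ , z″))
    refl x y z x′ y′ z′ x″ y″ z″

  ⨯-·ˡ : ∀ u v → (u ⨯ v) · u ≈ 0#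
  ⨯-·ˡ (x , y , z) (x′ , y′ , z′) = solve 6
    (λ x y z x′ y′ z′ → ((x , y , z) :⨯ (x′ , y′ , z′)) :· (x , y , z) := con (+ 0))
    refl x y z x′ y′ z′

  ⨯-·ʳ : ∀ u v → (u ⨯ v) · v ≈ 0#
  ⨯-·ʳ (x , y , z) (x′ , y′ , z′) = solve 6
    (λ x y z x′ y′ z′ → ((x , y , z) :⨯ (x′ , y′ , z′)) :· (x′ , y′ , z′) := con (+ 0))
    refl x y z x′ y′ z′

  *ᵣ-⨯ : ∀ u v r → (u *ᵣ r) ⨯ v ≈ᴹ (u ⨯ v) *ᵣ r
  *ᵣ-⨯ (x , y , z) (x′ , y′ , z′) r =
    coordinate y z y′ z′ r , coordinate z x z′ x′ r , coordinate x y x′ y′ r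
    where
    coordinate : ∀ x y x′ y′ r → x * r * y′ - y * r * x′ ≈ (x * y′ - y * x′) * r
    coordinate = solve 5
      (λ x y x′ y′ r → x :* r :* y′ :- y :* r :* x′ := (x :* y′ :- y :* x′) :* r) refl

  ⨯-zeroˡ : ∀ v → 0ᴹ ⨯ v ≈ᴹ 0ᴹ
  ⨯-zeroˡ (x , y , z) = coordinate z y , coordinate x z , coordinate y x
    where
    coordinate : ∀ x y → 0# * x - 0# * y ≈ 0#
    coordinate = solve 2 (λ x y → con (+ 0) :* x :- con (+ 0) :* y := con (+ 0)) refl

  -- Lagrange's expansion of the triple product. The minus sign sits in the scalar, so that the
  -- right side is literally a linear combination of `u` and `v`.
  triple-productˡ : ∀ u v w → (u ⨯ v) ⨯ w ≈ᴹ v *ᵣ (u · w) +ᴹ u *ᵣ (- (v · w))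
  triple-productˡ (x , y , z) (x′ , y′ , z′) (x″ , y″ , z″) =
    solve 9
      (λ x y z x′ y′ z′ x″ y″ z″ →
        let u = x , y , z; v = x′ , y′ , z′; w = x″ , y″ , z″ in
        proj₁ ((u :⨯ v) :⨯ w) := x′ :* (u :· w) :+ x :* (:- (v :· w)))
      refl x y z x′ y′ z′ x″ y″ z″ ,
    solve 9
      (λ x y z x′ y′ z′ x″ y″ z″ →
        let u = x , y , z; v = x′ , y′ , z′; w = x″ , y″ , z″ in
        proj₁ (proj₂ ((u :⨯ v) :⨯ w)) := y′ :* (u :· w) :+ y :* (:- (v :· w)))
      refl x y z x′ y′ z′ x″ y″ z″ ,
    solve 9
      (λ x y z x′ y′ z′ x″ y″ z″ →
        let u = x , y , z; v = x′ , y′ , z′; w = x″ , y″ , z″ in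
        proj₂ (proj₂ ((u :⨯ v) :⨯ w)) := z′ :* (u :· w) :+ z :* (:- (v :· w)))
      refl x y z x′ y′ z′ x″ y″ z″

  -- The companion expansion; the factor is written `w · u` to match the form in which a
  -- unimodularity witness is given.
  triple-productʳ : ∀ u v w → u ⨯ (v ⨯ w) ≈ᴹ v *ᵣ (w · u) +ᴹ w *ᵣ (- (u · v))
  triple-productʳ (x , y , z) (x′ , y′ , z′) (x″ , y″ , z″) =
    solve 9
      (λ x y z x′ y′ z′ x″ y″ z″ →
        let u = x , y , z; v = x′ , y′ , z′; w = x″ , y″ , z″ in
        proj₁ (u :⨯ (v :⨯ w)) := x′ :* (w :· u) :+ x″ :* (:- (u :· v)))
      refl x y z x′ y′ z′ x″ y″ z″ ,
    solve 9
      (λ x y z x′ y′ z′ x″ y″ z″ →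
        let u = x , y , z; v = x′ , y′ , z′; w = x″ , y″ , z″ in
        proj₁ (proj₂ (u :⨯ (v :⨯ w))) := y′ :* (w :· u) :+ y″ :* (:- (u :· v)))
      refl x y z x′ y′ z′ x″ y″ z″ ,
    solve 9
      (λ x y z x′ y′ z′ x″ y″ z″ →
        let u = x , y , z; v = x′ , y′ , z′; w = x″ , y″ , z″ in
        proj₂ (proj₂ (u :⨯ (v :⨯ w))) := z′ :* (w :· u) :+ z″ :* (:- (u :· v)))
      refl x y z x′ y′ z′ x″ y″ z″

  -- Unimodular vectors and the points they span.

  -- The witness `w` is a linear form that reads off the coefficient of any multiple of `v`. This
  -- gives freeness of the span and a membership test.
  Unimodular : V → Set (c ⊔ ℓ)
  Unimodular v = ∃[ w ] w · v ≈ 1#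

  UnimodularVector : Set (c ⊔ ℓ)
  UnimodularVector = Σ V Unimodular

  unimodular-coefficient : ∀ {v w} → w · v ≈ 1# → ∀ r → w · (v *ᵣ r) ≈ r
  unimodular-coefficient {v} {w} w·v≈1 r =
    trans (·-*ᵣ w v r) (trans (*-congʳ w·v≈1) (*-identityˡ r))

  unimodular-cancel : ∀ {v} → Unimodular v → ∀ {r} → v *ᵣ r ≈ᴹ 0ᴹ → r ≈ 0#
  unimodular-cancel {v} (w , w·v≈1) {r} vr≈0 =
    trans (sym (unimodular-coefficient w·v≈1 r)) (trans (·-cong {w} ≈ᴹ-refl vr≈0) (·-zeroʳ w))

  ⟨_⟩ : UnimodularVector → Point
  ⟨ v , v-unimodular ⟩ =
    record
      { Member    = λ x → ∃[ r ] x ≈ᴹ v *ᵣ r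
      ; resp      = λ x≈y (r , x≈vr) → r , ≈ᴹ-trans (≈ᴹ-sym x≈y) x≈vr
      ; 0-closed  = 0# , ≈ᴹ-sym (*ᵣ-zeroʳ v)
      ; +-closed  = λ (r , x≈vr) (s , y≈vs) →
          r + s , ≈ᴹ-trans (+ᴹ-cong x≈vr y≈vs) (≈ᴹ-sym (*ᵣ-distribˡ v r s))
      ; *ᵣ-closed = λ s (r , x≈vr) →
          r * s , ≈ᴹ-trans (*ᵣ-cong x≈vr refl) (*ᵣ-assoc v r s)
      } ,
    const v ,
    record
      { members     = λ _ → 1# , ≈ᴹ-sym (*ᵣ-identityʳ v)
      ; independent = λ where
          r vr≈0 zero → unimodular-cancel v-unimodular (≈ᴹ-trans (≈ᴹ-sym (+ᴹ-identityʳ _)) vr≈0)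
      ; spanning    = λ (r , x≈vr) → const r , ≈ᴹ-trans x≈vr (≈ᴹ-sym (+ᴹ-identityʳ _))
      }

  -- Vectors are compared by their spans, so absence of repetitions carries over to lists of points
  -- unchanged.
  unimodularSetoid : Setoid (c ⊔ ℓ) (c ⊔ ℓ)
  unimodularSetoid = On.setoid pointSetoid ⟨_⟩

  generator∈ : ∀ n → Member (proj₁ ⟨ n ⟩) (proj₁ n)
  generator∈ (v , _) = 1# , ≈ᴹ-sym (*ᵣ-identityʳ v)

  ⟨⟩⊆ : ∀ n N → Member N (proj₁ n) → proj₁ ⟨ n ⟩ ⊆ N
  ⟨⟩⊆ _ N v∈N x (r , x≈vr) = resp N (≈ᴹ-sym x≈vr) (*ᵣ-closed N r v∈N)

  ⟨⟩≈⇒multiple : ∀ {m n} → ⟨ m ⟩ ≈ᴾ ⟨ n ⟩ → ∃[ r ] proj₁ m ≈ᴹ proj₁ n *ᵣ r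
  ⟨⟩≈⇒multiple {m} (m⊆n , _) = m⊆n (proj₁ m) (generator∈ m)

  -- Canonical vectors, one for each point.

  torsion-* : ∀ {x} → x * π ≈ 0# → ∀ r → x * r * π ≈ 0#
  torsion-* {x} xπ≈0 r = begin
    x * r * π    ≈⟨ solve 3 (λ x r π → x :* r :* π := x :* π :* r) refl x r π ⟩
    x * π * r    ≈⟨ *-congʳ xπ≈0 ⟩
    0# * r       ≈⟨ zeroˡ r ⟩
    0#           ∎
    where open SetoidReasoning setoid

  -- Multiplying by `π` would give `π` = 0. Elements annihilated by `π` are thus never units, which
  -- keeps the three charts apart.
  1≉torsion* : ∀ {x} → x * π ≈ 0# → ∀ {r} → ¬ (1# ≈ x * r)
  1≉torsion* xπ≈0 {r} 1≈xr =
    π≉0 (trans (sym (*-identityˡ π)) (trans (*-congʳ 1≈xr) (torsion-* xπ≈0 r)))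

  e₁ e₂ e₃ : V
  e₁ = 1# , 0# , 0#
  e₂ = 0# , 1# , 0#
  e₃ = 0# , 0# , 1#

  e₁· : ∀ v → e₁ · v ≈ proj₁ v
  e₁· (x , y , z) = trans
    (+-cong (*-identityˡ x) (trans (+-cong (zeroˡ y) (zeroˡ z)) (+-identityˡ 0#))) (+-identityʳ x)

  e₂· : ∀ v → e₂ · v ≈ proj₁ (proj₂ v)
  e₂· (x , y , z) = trans
    (+-cong (zeroˡ x) (trans (+-cong (*-identityˡ y) (zeroˡ z)) (+-identityʳ y))) (+-identityˡ y)

  e₃· : ∀ v → e₃ · v ≈ proj₂ (proj₂ v)
  e₃· (x , y , z) = trans
    (+-cong (zeroˡ x) (trans (+-cong (zeroˡ y) (*-identityˡ z)) (+-identityˡ z))) (+-identityˡ z)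

  chart₁ chart₂ chart₃ : Carrier → Carrier → UnimodularVector
  chart₁ a b = (1# , a , b) , e₁ , e₁· (1# , a , b)
  chart₂ a b = (a , 1# , b) , e₂ , e₂· (a , 1# , b)
  chart₃ a b = (a , b , 1#) , e₃ , e₃· (a , b , 1#)

  torsion? : Unary.Decidable (λ x → x * π ≈ 0#)
  torsion? x = x * π ≟ 0#

  -- The maximal ideal, as the annihilator of `π`: by `unit⊎torsion` and `1≉torsion*` it consists of
  -- the non-units.
  radical : List Carrier
  radical = filter torsion? elements

  -- The charts normalise the first unit coordinate to 1. Both rings have 9 elements and 3
  -- non-units, which gives 81 + 27 + 9 = 117 vectors.
  canonical₁ canonical₂ canonical₃ canonical : List UnimodularVector
  canonical₁ = cartesianProductWith chart₁ elements elements
  canonical₂ = cartesianProductWith chart₂ radical elements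
  canonical₃ = cartesianProductWith chart₃ radical radical
  canonical  = canonical₁ ++ canonical₂ ++ canonical₃

  open Membership setoid using (_∈_)
  open UniqueSetoid setoid using (Unique)
  open UniqueSetoid unimodularSetoid using () renaming (Unique to Uniqueᵘ)

  torsion-resp : (λ x → x * π ≈ 0#) Respects _≈_
  torsion-resp x≈y = trans (*-congʳ (sym x≈y))

  ∈-radical : ∀ {x} → x * π ≈ 0# → x ∈ radical
  ∈-radical = Membershipₚ.∈-filter⁺ setoid torsion? torsion-resp (∈-elements _)

  ∈-radical⇒torsion : ∀ {x} → x ∈ radical → x * π ≈ 0#
  ∈-radical⇒torsion = proj₂ ∘ Membershipₚ.∈-filter⁻ setoid torsion? torsion-resp {xs = elements}

  radical! : Unique radical
  radical! = Uniqueₚ.filter⁺ setoid torsion? elements!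

  -- Within a chart the coordinate 1 forces the scalar to be 1, so the other coordinates agree.
  -- Between charts, the 1 of the earlier one would be a multiple of a radical element.
  canonical! : Uniqueᵘ canonical
  canonical! = AllPairsₚ.++⁺ unique₁ (AllPairsₚ.++⁺ unique₂ unique₃ disjoint₂₃) disjoint₁
    where
    cancel-1 : ∀ {a b r} → 1# ≈ 1# * r → a ≈ b * r → a ≈ b
    cancel-1 {a} {b} {r} 1≈r a≈br =
      trans a≈br (trans (*-congˡ (sym (trans 1≈r (*-identityˡ r)))) (*-identityʳ b))

    unique₁ : Uniqueᵘ canonical₁
    unique₁ = Uniqueₚ.cartesianProductWith⁺ setoid setoid unimodularSetoid chart₁
      (λ {a} {a′} {b} {b′} eq →
        let r , 1≈r , a≈ , b≈ = ⟨⟩≈⇒multiple {chart₁ a b} {chart₁ a′ b′} eq in cancel-1 1≈r a≈ , cancel-1 1≈r b≈)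
      elements! elements!

    unique₂ : Uniqueᵘ canonical₂
    unique₂ = Uniqueₚ.cartesianProductWith⁺ setoid setoid unimodularSetoid chart₂
      (λ {a} {a′} {b} {b′} eq →
        let r , a≈ , 1≈r , b≈ = ⟨⟩≈⇒multiple {chart₂ a b} {chart₂ a′ b′} eq in cancel-1 1≈r a≈ , cancel-1 1≈r b≈)
      radical! elements!

    unique₃ : Uniqueᵘ canonical₃
    unique₃ = Uniqueₚ.cartesianProductWith⁺ setoid setoid unimodularSetoid chart₃
      (λ {a} {a′} {b} {b′} eq →
        let r , a≈ , b≈ , 1≈r = ⟨⟩≈⇒multiple {chart₃ a b} {chart₃ a′ b′} eq in cancel-1 1≈r a≈ , cancel-1 1≈r b≈)
      radical! radical!

    open Setoid unimodularSetoid using () renaming (_≈_ to _≈ᵘ_)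

    disjoint₁ : All (λ m → All (λ n → ¬ (m ≈ᵘ n)) (canonical₂ ++ canonical₃)) canonical₁
    disjoint₁ = Allₚ.cartesianProductWith⁺ setoid setoid chart₁ elements elements λ {a} {b} _ _ → Allₚ.++⁺
      (Allₚ.cartesianProductWith⁺ setoid setoid chart₂ radical elements λ {a′} {b′} a′∈ _ eq →
        1≉torsion* (∈-radical⇒torsion a′∈) (proj₁ (proj₂ (⟨⟩≈⇒multiple {chart₁ a b} {chart₂ a′ b′} eq))))
      (Allₚ.cartesianProductWith⁺ setoid setoid chart₃ radical radical λ {a′} {b′} a′∈ _ eq →
        1≉torsion* (∈-radical⇒torsion a′∈) (proj₁ (proj₂ (⟨⟩≈⇒multiple {chart₁ a b} {chart₃ a′ b′} eq))))

    disjoint₂₃ : All (λ m → All (λ n → ¬ (m ≈ᵘ n)) canonical₃) canonical₂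
    disjoint₂₃ = Allₚ.cartesianProductWith⁺ setoid setoid chart₂ radical elements λ {a} {b} _ _ →
      Allₚ.cartesianProductWith⁺ setoid setoid chart₃ radical radical λ {a′} {b′} _ b′∈ eq →
        1≉torsion* (∈-radical⇒torsion b′∈) (proj₁ (proj₂ (proj₂ (⟨⟩≈⇒multiple {chart₂ a b} {chart₃ a′ b′} eq))))

  unit-coordinate⇒unimodular : ∀ {v} e {t u} → e · v ≈ t → t * u ≈ 1# → Unimodular v
  unit-coordinate⇒unimodular {v} e {t} {u} e·v≈t tu≈1 = e *ᵣ u , (begin
    (e *ᵣ u) · v    ≈⟨ ·-comm (e *ᵣ u) v ⟩
    v · (e *ᵣ u)    ≈⟨ ·-*ᵣ v e u ⟩
    (v · e) * u     ≈⟨ *-congʳ (trans (·-comm v e) e·v≈t) ⟩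
    t * u           ≈⟨ tu≈1 ⟩
    1#              ∎)
    where open SetoidReasoning setoid

  -- Reduces a proof of unimodularity to excluding annihilation by `π`, which independence of a
  -- basis can refute.
  unimodular⊎torsion : ∀ v → Unimodular v ⊎ v *ᵣ π ≈ᴹ 0ᴹ
  unimodular⊎torsion v@(x , y , z) with unit⊎torsion x | unit⊎torsion y | unit⊎torsion z
  ... | inj₁ (_ , xu≈1) | _               | _               =
    inj₁ (unit-coordinate⇒unimodular e₁ (e₁· v) xu≈1)
  ... | inj₂ _          | inj₁ (_ , yu≈1) | _               =
    inj₁ (unit-coordinate⇒unimodular e₂ (e₂· v) yu≈1)
  ... | inj₂ _          | inj₂ _          | inj₁ (_ , zu≈1) =
    inj₁ (unit-coordinate⇒unimodular e₃ (e₃· v) zu≈1)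
  ... | inj₂ xπ≈0       | inj₂ yπ≈0       | inj₂ zπ≈0       = inj₂ (xπ≈0 , yπ≈0 , zπ≈0)

  linearCombination-zero : ∀ {n} (b : Vector.Vector V n) → linearCombination b (const 0#) ≈ᴹ 0ᴹ
  linearCombination-zero {zero}  b = ≈ᴹ-refl
  linearCombination-zero {suc n} b = ≈ᴹ-trans
    (+ᴹ-cong (*ᵣ-zeroʳ (b zero)) (linearCombination-zero (b ∘ suc))) (+ᴹ-identityʳ 0ᴹ)

  module _ {N : Submodule} {n} {b : Vector.Vector V (suc n)} (b-basis : IsBasis N b) where

    -- Otherwise π, 0, ..., 0 would be the coefficients of a nontrivial relation.
    basis-head-torsion-free : ¬ (b zero *ᵣ π ≈ᴹ 0ᴹ)
    basis-head-torsion-free bπ≈0 = π≉0 (IsBasis.independent b-basis (π Vector.∷ const 0#)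
      (≈ᴹ-trans (+ᴹ-cong bπ≈0 (linearCombination-zero (b ∘ suc))) (+ᴹ-identityʳ 0ᴹ)) zero)

    basis-head-unimodular : Unimodular (b zero)
    basis-head-unimodular with unimodular⊎torsion (b zero)
    ... | inj₁ unimodular = unimodular
    ... | inj₂ torsion    = contradiction torsion basis-head-torsion-free

  -- Divide the basis vector by its first unit coordinate `t`; multiplying by `t` undoes this, so
  -- both vectors span the same point.
  canonical-complete : ∀ P → Any (λ n → P ≈ᴾ ⟨ n ⟩) canonical
  canonical-complete P@(N , b , b-basis) = normalise (b zero) ≡.refl
    where
    scaled : ∀ {t u} n → t * u ≈ 1# → proj₁ n ≈ᴹ b zero *ᵣ u → P ≈ᴾ ⟨ n ⟩
    scaled {t} {u} n@(v , _) tu≈1 v≈bu =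
      (λ x x∈N → let r , x≈br = IsBasis.spanning b-basis x∈N in
        resp (proj₁ ⟨ n ⟩) {b zero *ᵣ r zero} (≈ᴹ-trans (≈ᴹ-sym (+ᴹ-identityʳ _)) (≈ᴹ-sym x≈br))
          (*ᵣ-closed (proj₁ ⟨ n ⟩) (r zero) (t , b≈vt))) ,
      ⟨⟩⊆ n N (resp N (≈ᴹ-sym v≈bu) (*ᵣ-closed N u (IsBasis.members b-basis zero)))
      where
      open SetoidReasoning ≈ᴹ-setoid
      b≈vt : b zero ≈ᴹ v *ᵣ t
      b≈vt = begin
        b zero              ≈⟨ *ᵣ-identityʳ (b zero) ⟨
        b zero *ᵣ 1#        ≈⟨ *ᵣ-cong ≈ᴹ-refl (trans (*-comm u t) tu≈1) ⟨
        b zero *ᵣ (u * t)   ≈⟨ *ᵣ-assoc (b zero) u t ⟨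
        (b zero *ᵣ u) *ᵣ t  ≈⟨ *ᵣ-cong v≈bu refl ⟨
        v *ᵣ t              ∎

    -- The equation serves to name the coordinates of `b zero`.
    normalise : ∀ v → b zero ≡ v → Any (λ n → P ≈ᴾ ⟨ n ⟩) canonical
    normalise (x , y , z) ≡.refl with unit⊎torsion x | unit⊎torsion y | unit⊎torsion z
    ... | inj₁ (u , xu≈1) | _ | _ = Anyₚ.++⁺ˡ (Anyₚ.cartesianProductWith⁺ chart₁
      (λ {a} {b} yu≈a zu≈b → scaled (chart₁ a b) xu≈1 (sym xu≈1 , sym yu≈a , sym zu≈b))
      (∈-elements (y * u)) (∈-elements (z * u)))
    ... | inj₂ xπ≈0 | inj₁ (u , yu≈1) | _ = Anyₚ.++⁺ʳ canonical₁ (Anyₚ.++⁺ˡ (Anyₚ.cartesianProductWith⁺ chart₂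
      (λ {a} {b} xu≈a zu≈b → scaled (chart₂ a b) yu≈1 (sym xu≈a , sym yu≈1 , sym zu≈b))
      (∈-radical (torsion-* xπ≈0 u)) (∈-elements (z * u))))
    ... | inj₂ xπ≈0 | inj₂ yπ≈0 | inj₁ (u , zu≈1) = Anyₚ.++⁺ʳ canonical₁ (Anyₚ.++⁺ʳ canonical₂ (Anyₚ.cartesianProductWith⁺ chart₃
      (λ {a} {b} xu≈a yu≈b → scaled (chart₃ a b) zu≈1 (sym xu≈a , sym yu≈b , sym zu≈1))
      (∈-radical (torsion-* xπ≈0 u)) (∈-radical (torsion-* yπ≈0 u))))
    ... | inj₂ xπ≈0 | inj₂ yπ≈0 | inj₂ zπ≈0 =
      contradiction (xπ≈0 , yπ≈0 , zπ≈0) (basis-head-torsion-free b-basis)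

  -- Lines as kernels of linear forms.

  _isKernelOf_ : Line → UnimodularVector → Set (c ⊔ ℓ)
  L isKernelOf n = ∀ x → Member (proj₁ L) x ⇔ proj₁ n · x ≈ 0#

  module _ (L : Line) where

    private
      N : Submodule
      N = proj₁ L

      b : Vector.Vector V 2
      b = proj₁ (proj₂ L)

      b-basis : IsBasis N b
      b-basis = proj₂ (proj₂ L)

      u v f : V
      u = b zero
      v = b (suc zero)
      f = u ⨯ v

    -- If `π` annihilated `f`, then taking `w` with `w · u` = 1 would give a relation between `u`
    -- and `v` whose coefficient at `v` is `π`, against independence.
    normal-unimodular : Unimodular f
    normal-unimodular with unimodular⊎torsion f
    ... | inj₁ unimodular = unimodular
    ... | inj₂ fπ≈0       = contradiction u·wπ≈0 u·wπ≉0
      where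
      open SetoidReasoning ≈ᴹ-setoid

      w : V
      w = proj₁ (basis-head-unimodular b-basis)

      u·w≈1 : u · w ≈ 1#
      u·w≈1 = trans (·-comm u w) (proj₂ (basis-head-unimodular b-basis))

      -- (fπ) ⨯ w = 0 expands, by the triple product formula, to a relation
      -- between u and v.
      relation : u *ᵣ (- (v · w) * π) +ᴹ (v *ᵣ ((u · w) * π) +ᴹ 0ᴹ) ≈ᴹ 0ᴹ
      relation = begin
        u *ᵣ (- (v · w) * π) +ᴹ (v *ᵣ ((u · w) * π) +ᴹ 0ᴹ)      ≈⟨ +ᴹ-cong ≈ᴹ-refl (+ᴹ-identityʳ _) ⟩
        u *ᵣ (- (v · w) * π) +ᴹ v *ᵣ ((u · w) * π)              ≈⟨ +ᴹ-comm _ _ ⟩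
        v *ᵣ ((u · w) * π) +ᴹ u *ᵣ (- (v · w) * π)              ≈⟨ +ᴹ-cong (*ᵣ-assoc v (u · w) π) (*ᵣ-assoc u (- (v · w)) π) ⟨
        (v *ᵣ (u · w)) *ᵣ π +ᴹ (u *ᵣ (- (v · w))) *ᵣ π          ≈⟨ *ᵣ-distribʳ π (v *ᵣ (u · w)) (u *ᵣ (- (v · w))) ⟨
        (v *ᵣ (u · w) +ᴹ u *ᵣ (- (v · w))) *ᵣ π                 ≈⟨ *ᵣ-cong (triple-productˡ u v w) refl ⟨
        (f ⨯ w) *ᵣ π                                            ≈⟨ *ᵣ-⨯ f w π ⟨
        (f *ᵣ π) ⨯ w                                            ≈⟨ ⨯-congʳ w fπ≈0 ⟩
        0ᴹ ⨯ w                                                  ≈⟨ ⨯-zeroˡ w ⟩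
        0ᴹ                                                      ∎

      u·wπ≈0 : (u · w) * π ≈ 0#
      u·wπ≈0 = IsBasis.independent b-basis
        (- (v · w) * π Vector.∷ (u · w) * π Vector.∷ Vector.[]) relation (suc zero)

      u·wπ≉0 : ¬ ((u · w) * π ≈ 0#)
      u·wπ≉0 eq = π≉0 (trans (sym (*-identityˡ π)) (trans (*-congʳ (sym u·w≈1)) eq))

    normal-⟂ : ∀ {x} → Member N x → f · x ≈ 0#
    normal-⟂ {x} x∈N = let r , x≈ur+vs = IsBasis.spanning b-basis x∈N in begin
      f · x                                                     ≈⟨ ·-cong {f} ≈ᴹ-refl x≈ur+vs ⟩
      f · (u *ᵣ r zero +ᴹ (v *ᵣ r (suc zero) +ᴹ 0ᴹ))            ≈⟨ ·-cong {f} ≈ᴹ-refl (+ᴹ-cong ≈ᴹ-refl (+ᴹ-identityʳ _)) ⟩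
      f · (u *ᵣ r zero +ᴹ v *ᵣ r (suc zero))                    ≈⟨ ·-+ᴹ f _ _ ⟩
      f · (u *ᵣ r zero) + f · (v *ᵣ r (suc zero))               ≈⟨ +-cong (·-*ᵣ f u _) (·-*ᵣ f v _) ⟩
      f · u * r zero + f · v * r (suc zero)                     ≈⟨ +-cong (*-congʳ (⨯-·ˡ u v)) (*-congʳ (⨯-·ʳ u v)) ⟩
      0# * r zero + 0# * r (suc zero)                           ≈⟨ +-cong (zeroˡ _) (zeroˡ _) ⟩
      0# + 0#                                                   ≈⟨ +-identityʳ 0# ⟩
      0#                                                        ∎
      where open SetoidReasoning setoid

    -- If w · f = 1 and f · x = 0 then x = f ⨯ (x ⨯ w), which the triple product
    -- formula for (u ⨯ v) ⨯ _ writes as a combination of u and v.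
    ⟂-normal : ∀ {x} → f · x ≈ 0# → Member N x
    ⟂-normal {x} f·x≈0 = resp N (≈ᴹ-trans (≈ᴹ-sym (triple-productˡ u v (x ⨯ w))) (≈ᴹ-sym x≈f⨯[x⨯w]))
      (+-closed N (*ᵣ-closed N _ (IsBasis.members b-basis (suc zero)))
                  (*ᵣ-closed N _ (IsBasis.members b-basis zero)))
      where
      open SetoidReasoning ≈ᴹ-setoid
      w = proj₁ normal-unimodular

      x≈f⨯[x⨯w] : x ≈ᴹ f ⨯ (x ⨯ w)
      x≈f⨯[x⨯w] = begin
        x                                     ≈⟨ +ᴹ-identityʳ x ⟨
        x +ᴹ 0ᴹ                               ≈⟨ +ᴹ-cong (*ᵣ-identityʳ x) (*ᵣ-zeroʳ w) ⟨
        x *ᵣ 1# +ᴹ w *ᵣ 0#                    ≈⟨ +ᴹ-cong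
                                                   (*ᵣ-cong ≈ᴹ-refl (proj₂ normal-unimodular))
                                                   (*ᵣ-cong ≈ᴹ-refl (trans (-‿cong f·x≈0) -0#≈0#)) ⟨
        x *ᵣ (w · f) +ᴹ w *ᵣ (- (f · x))      ≈⟨ triple-productʳ f x w ⟨
        f ⨯ (x ⨯ w)                           ∎

    -- The normal `f` spans the same point as some canonical vector. Each is then a multiple of the
    -- other, so the two forms vanish on the same vectors.
    line-is-kernel : Any (L isKernelOf_) canonical
    line-is-kernel = Any.map (λ {n} f≈n x → mk⇔
        (λ x∈N → ⟂-resp x (⟨⟩≈⇒multiple {n} {f , normal-unimodular} (swap f≈n)) (normal-⟂ x∈N))
        (λ n·x≈0 → ⟂-normal (⟂-resp x (⟨⟩≈⇒multiple {f , normal-unimodular} {n} f≈n) n·x≈0)))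
      (canonical-complete ⟨ f , normal-unimodular ⟩)
      where
      ⟂-resp : ∀ {g h} x → ∃[ r ] g ≈ᴹ h *ᵣ r → h · x ≈ 0# → g · x ≈ 0#
      ⟂-resp {g} {h} x (r , g≈hr) h·x≈0 = begin
        g · x           ≈⟨ ·-cong {v = x} g≈hr ≈ᴹ-refl ⟩
        (h *ᵣ r) · x    ≈⟨ ·-comm (h *ᵣ r) x ⟩
        x · (h *ᵣ r)    ≈⟨ ·-*ᵣ x h r ⟩
        x · h * r       ≈⟨ *-congʳ (trans (·-comm x h) h·x≈0) ⟩
        0# * r          ≈⟨ zeroˡ r ⟩
        0#              ∎
        where open SetoidReasoning setoid

  -- Incidence and point counts as finite computations.

  infix 4 _⟂_ _⟂?_

  _⟂_ : UnimodularVector → UnimodularVector → Set ℓ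
  m ⟂ n = proj₁ m · proj₁ n ≈ 0#

  _⟂?_ : Decidable _⟂_
  m ⟂? n = proj₁ m · proj₁ n ≟ 0#

  open Membership pointSetoid using () renaming (_∈_ to _∈ᴾ_)

  on⇔⟂ : ∀ L {n} → L isKernelOf n → ∀ m → (⟨ m ⟩ on L) ⇔ n ⟂ m
  on⇔⟂ (N , _) N⇔⟂n m = mk⇔
    (λ m⊆N → Equivalence.to (N⇔⟂n _) (m⊆N _ (generator∈ m)))
    (λ n⟂m → ⟨⟩⊆ m N (Equivalence.from (N⇔⟂n _) n⟂m))

  on-resp : ∀ L → (_on L) Respects _≈ᴾ_
  on-resp L (_ , Q⊆P) P⊆L x = P⊆L x ∘ Q⊆P x

  -- Inclusion quantifies over all vectors; canonical representatives of the point and the line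
  -- reduce it to one scalar product.
  on? : ∀ L → Unary.Decidable (_on L)
  on? L P =
    let n , N⇔⟂n = Any.satisfied (line-is-kernel L)
        m , P≈m  = Any.satisfied (canonical-complete P)
    in Dec.map′
      (on-resp L {⟨ m ⟩} {P} (swap P≈m) ∘ Equivalence.from (on⇔⟂ L {n} N⇔⟂n m))
      (Equivalence.to (on⇔⟂ L {n} N⇔⟂n m) ∘ on-resp L {P} {⟨ m ⟩} P≈m)
      (n ⟂? m)

  |points| : HasCardinality {p = 0ℓ} U (length canonical)
  |points| =
    map ⟨_⟩ canonical ,
    Uniqueₚ.map⁺ unimodularSetoid pointSetoid id canonical! ,
    (λ P → mk⇔ (λ _ → Anyₚ.map⁺ (canonical-complete P)) (λ _ → tt)) ,
    length-map ⟨_⟩ canonical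

  infix 4 _≟ᴾ_

  _≟ᴾ_ : Decidable _≈ᴾ_
  P ≟ᴾ Q =
    let m , P≈m = Any.satisfied (canonical-complete P)
        n , Q≈n = Any.satisfied (canonical-complete Q)
    in Dec.map′
      (λ m≈n → ≈ᴾ.trans {P} {⟨ m ⟩} {Q} P≈m (≈ᴾ.trans {⟨ m ⟩} {⟨ n ⟩} {Q} m≈n (≈ᴾ.sym {Q} {⟨ n ⟩} Q≈n)))
      (λ P≈Q → ≈ᴾ.trans {⟨ m ⟩} {P} {⟨ n ⟩} (≈ᴾ.sym {P} {⟨ m ⟩} P≈m) (≈ᴾ.trans {P} {Q} {⟨ n ⟩} P≈Q Q≈n))
      (m ⊆? n ×-dec n ⊆? m)
    where
    module ≈ᴾ = Setoid pointSetoid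

    _⊆?_ : ∀ m n → Dec (proj₁ ⟨ m ⟩ ⊆ proj₁ ⟨ n ⟩)
    -- If `u` is a multiple of `v` at all, the coefficient must be `w · u`, so only this one is
    -- tested.
    m@(u , _) ⊆? n@(v , w , w·v≈1) = Dec.map′
      (λ u≈v[w·u] → ⟨⟩⊆ m (proj₁ ⟨ n ⟩) (w · u , u≈v[w·u]))
      (λ m⊆n → let r , u≈vr = m⊆n u (generator∈ m) in
        ≈ᴹ-trans u≈vr (*ᵣ-cong (≈ᴹ-refl {v})
          (sym (trans (·-cong {w} ≈ᴹ-refl u≈vr) (unimodular-coefficient {v} {w} w·v≈1 r)))))
      (×-decidable _≟_ (×-decidable _≟_ _≟_) u (v *ᵣ (w · u)))

  module _ {ms : List UnimodularVector} (ms! : Uniqueᵘ ms) where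

    pointSet : PointSet
    pointSet = record
      { _∋_      = _∈ᴾ map ⟨_⟩ ms
      ; respects = λ {P} {Q} → Membershipₚ.∈-resp-≈ pointSetoid {x = P} {y = Q}
      ; _∋?_     = λ P → Any.any? (P ≟ᴾ_) (map ⟨_⟩ ms)
      }

    |pointSet| : HasCardinality (pointSet ∋_) (length ms)
    |pointSet| =
      map ⟨_⟩ ms ,
      Uniqueₚ.map⁺ unimodularSetoid pointSetoid id ms! ,
      (λ _ → mk⇔ id id) ,
      length-map ⟨_⟩ ms

    -- Filtering by `on?` enumerates the intersection; its length is then rewritten as a count of
    -- vanishing scalar products with `n`, which depends on the line only through `n`.
    |pointSet∩line| : ∀ L {n} → L isKernelOf n →
      HasCardinality (pointSet ∩ L) (length (filter (n ⟂?_) ms))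
    |pointSet∩line| L {n} N⇔⟂n =
      ≡.subst (HasCardinality (pointSet ∩ L))
        (length-filter-map (on? L) (n ⟂?_) ⟨_⟩ (on⇔⟂ L {n} N⇔⟂n) ms)
        (HasCardinality-resp {S = pointSetoid} (λ _ → mk⇔ swap swap)
          (HasCardinality-filter {S = pointSetoid} (on? L) (λ {P} {Q} → on-resp L {P} {Q}) |pointSet|))

  |line| : ∀ L {n} → L isKernelOf n →
    HasCardinality (_on L) (length (filter (n ⟂?_) canonical))
  |line| L {n} N⇔⟂n = HasCardinality-resp {S = pointSetoid}
    (λ P → mk⇔ proj₂ (Anyₚ.map⁺ (canonical-complete P) ,_))
    (|pointSet∩line| canonical! L {n} N⇔⟂n)

  -- Every line is the kernel of a canonical vector, so checks over `canonical` cover all lines;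
  -- `All.lookupAny` retrieves the check for the vector belonging to `L`.
  blocking-set-by-counting : ∀ {k k′ n n′} → length canonical ≡ k ℕ.+ k′ →
    All (λ m → length (filter (m ⟂?_) canonical) ≡ n ℕ.+ n′) canonical →
    ∀ {ms} → Uniqueᵘ ms → length ms ≡ k →
    All (λ m → n ≤ length (filter (m ⟂?_) ms)) canonical →
    (∃[ B ] IsBlockingSet k n B)
    × (∃[ K ] IsProjectiveArc k′ n′ K)
    × (∀ B → IsBlockingSet k n B ⇔ IsProjectiveArc k′ n′ (∁ B))
  blocking-set-by-counting {k} {k′} {n} {n′} |canonical| |kernel| {ms} ms! |ms| |kernel∩ms| =
    (pointSet ms! , blocking) ,
    (∁ (pointSet ms!) , Equivalence.to (complement (pointSet ms!)) blocking) ,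
    complement
    where
    complement : ∀ B → IsBlockingSet k n B ⇔ IsProjectiveArc k′ n′ (∁ B)
    complement = blocking⇔arc R
      (≡.subst (HasCardinality U) |canonical| |points|)
      (λ L → let eq , N⇔⟂m = All.lookupAny |kernel| (line-is-kernel L) in
        ≡.subst (HasCardinality (_on L)) eq (|line| L {Any.lookup (line-is-kernel L)} N⇔⟂m))

    blocking : IsBlockingSet k n (pointSet ms!)
    blocking =
      ≡.subst (HasCardinality (pointSet ms! ∋_)) |ms| (|pointSet| ms!) ,
      λ L → let n≤ , N⇔⟂m = All.lookupAny |kernel∩ms| (line-is-kernel L) in
        _ , |pointSet∩line| ms! L {Any.lookup (line-is-kernel L)} N⇔⟂m , n≤

-- The two chain rings of order 9.

ℤ₉-isFiniteLocalRing : FiniteLocalRing ℤ₉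
ℤ₉-isFiniteLocalRing = record
  { *-comm       = IntegersMod.*-comm 9
  ; _≟_          = Finₚ._≟_
  ; elements     = allFin 9
  ; elements!    = Uniqueₚ≡.allFin⁺ 9
  ; ∈-elements   = Membershipₚ≡.∈-allFin
  ; π            = π
  ; π≉0          = λ ()
  ; unit⊎torsion = from-yes (Finₚ.all? λ x → Finₚ.any? (λ u → x * u Finₚ.≟ 1#) ⊎-dec x * π Finₚ.≟ 0#)
  }
  where
  open Ring ℤ₉ using (_*_; 0#; 1#)

  π : Fin 9
  π = IntegersMod.[_] 9 3

𝕊₃-isFiniteLocalRing : FiniteLocalRing 𝕊₃
𝕊₃-isFiniteLocalRing = record
  { *-comm       = λ (a , b) (c , d) → 𝔽₃-*-comm a c ,
      ≡.trans (Ring.+-comm 𝔽₃ (Ring._*_ 𝔽₃ a d) (Ring._*_ 𝔽₃ b c))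
        (≡.cong₂ (Ring._+_ 𝔽₃) (𝔽₃-*-comm b c) (𝔽₃-*-comm a d))
  ; _≟_          = _≟_
  ; elements     = cartesianProduct (allFin 3) (allFin 3)
  ; elements!    = Uniqueₚ.cartesianProduct⁺ (≡.setoid _) (≡.setoid _) (Uniqueₚ≡.allFin⁺ 3) (Uniqueₚ≡.allFin⁺ 3)
  ; ∈-elements   = λ (a , b) → Anyₚ.cartesianProduct⁺ (Membershipₚ≡.∈-allFin a) (Membershipₚ≡.∈-allFin b)
  ; π            = X
  ; π≉0          = λ ()
  ; unit⊎torsion = λ (a , b) → [ (λ eq → inj₁ ((a , Ring.-_ 𝔽₃ b) , eq)) , inj₂ ]′ (unit⊎torsion a b)
  }
  where
  open Ring 𝕊₃ using (_≈_; _*_; 0#; 1#)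

  𝔽₃-*-comm : ∀ a b → Ring._*_ 𝔽₃ a b ≡ Ring._*_ 𝔽₃ b a
  𝔽₃-*-comm = IntegersMod.*-comm 3

  infix 4 _≟_

  X : Fin 3 × Fin 3
  X = zero , suc zero

  _≟_ : Decidable _≈_
  _≟_ = ×-decidable Finₚ._≟_ Finₚ._≟_

  -- (a + bX)(a − bX) = a², which is 1 unless a = 0.
  unit⊎torsion : ∀ a b → (a , b) * (a , Ring.-_ 𝔽₃ b) ≈ 1# ⊎ (a , b) * X ≈ 0#
  unit⊎torsion = from-yes (Finₚ.all? λ a → Finₚ.all? λ b →
    ((a , b) * (a , Ring.-_ 𝔽₃ b) ≟ 1#) ⊎-dec ((a , b) * X ≟ 0#))

-- Explicit blocking sets and their verification.

module BlockingSetTable {R : Ring c ℓ} (F : FiniteLocalRing R) (⟦_⟧ : ℕ → Ring.Carrier R) where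

  open Ring R using (Carrier)
  open RightModule (PHG.R³ R) using (_≈ᴹ_)
  open FiniteLocalRing F using (_≟_)
  open HjelmslevPlane F

  row : ℕ → ℕ → List ℕ → List (Carrier × Carrier × Carrier)
  row x y = map λ z → ⟦ x ⟧ , ⟦ y ⟧ , ⟦ z ⟧

  listed? : ∀ vs → Unary.Decidable (λ (m : UnimodularVector) → Any (proj₁ m ≈ᴹ_) vs)
  listed? vs m = Any.any? (×-decidable _≟_ (×-decidable _≟_ _≟_) (proj₁ m)) vs

  -- Filtering `canonical` rather than converting the table lets distinctness of the points follow
  -- from `canonical!`.
  select : List (Carrier × Carrier × Carrier) → List UnimodularVector
  select vs = filter (listed? vs) canonical

  select! : ∀ vs → UniqueSetoid.Unique unimodularSetoid (select vs)
  select! vs = Uniqueₚ.filter⁺ unimodularSetoid (listed? vs) canonical!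

module ℤ₉-plane where

  open HjelmslevPlane ℤ₉-isFiniteLocalRing public
  open BlockingSetTable ℤ₉-isFiniteLocalRing (IntegersMod.[_] 9)

  -- The complement of a (60,7)-arc found by heuristic search among the point
  -- sets invariant under a collineation group of order 3.
  table : List (Ring.Carrier ℤ₉ × Ring.Carrier ℤ₉ × Ring.Carrier ℤ₉)
  table =
    row 1 0 (4 ∷ 6 ∷ 8 ∷ []) ++
    row 1 1 (0 ∷ 2 ∷ 3 ∷ 4 ∷ 5 ∷ 6 ∷ 7 ∷ 8 ∷ []) ++
    row 1 2 (0 ∷ 1 ∷ 4 ∷ 6 ∷ 7 ∷ 8 ∷ []) ++
    row 1 3 (3 ∷ 5 ∷ 7 ∷ []) ++
    row 1 4 (1 ∷ 4 ∷ []) ++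
    row 1 5 (0 ∷ 2 ∷ 3 ∷ []) ++
    row 1 6 (0 ∷ 1 ∷ 2 ∷ []) ++
    row 1 7 (1 ∷ 2 ∷ 5 ∷ 7 ∷ 8 ∷ []) ++
    row 1 8 (3 ∷ 5 ∷ 6 ∷ []) ++
    row 0 1 (0 ∷ 1 ∷ 3 ∷ 5 ∷ 6 ∷ 7 ∷ 8 ∷ []) ++
    row 3 1 (1 ∷ 2 ∷ 4 ∷ 5 ∷ []) ++
    row 6 1 (2 ∷ 4 ∷ 7 ∷ 8 ∷ []) ++
    row 0 0 (1 ∷ []) ++
    row 0 3 (1 ∷ []) ++
    row 3 3 (1 ∷ []) ++
    row 3 6 (1 ∷ []) ++
    row 6 0 (1 ∷ []) ++
    row 6 6 (1 ∷ [])

  blockers : List UnimodularVector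
  blockers = select table

  -- The line size q² + q for q = 3, found by evaluating all 117 × 117 scalar products.
  |kernel| : All (λ m → length (filter (m ⟂?_) canonical) ≡ 12) canonical
  |kernel| = from-yes (All.all? (λ m → length (filter (m ⟂?_) canonical) ℕₚ.≟ 12) canonical)

  |kernel∩blockers| : All (λ m → 5 ≤ length (filter (m ⟂?_) blockers)) canonical
  |kernel∩blockers| = from-yes (All.all? (λ m → 5 ℕₚ.≤? length (filter (m ⟂?_) blockers)) canonical)

  blockers! : UniqueSetoid.Unique unimodularSetoid blockers
  blockers! = select! table

module 𝕊₃-plane where

  open HjelmslevPlane 𝕊₃-isFiniteLocalRing public
  open BlockingSetTable 𝕊₃-isFiniteLocalRing (λ n → IntegersMod.[_] 3 n , IntegersMod.[_] 3 (n / 3))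

  -- The complement of a (60,7)-arc found by heuristic search among the point
  -- sets invariant under a collineation group of order 18; here a + 3b stands
  -- for a + bX.
  table : List (Ring.Carrier 𝕊₃ × Ring.Carrier 𝕊₃ × Ring.Carrier 𝕊₃)
  table =
    row 1 0 (3 ∷ 4 ∷ 6 ∷ 8 ∷ []) ++
    row 1 1 (1 ∷ 2 ∷ 6 ∷ 8 ∷ []) ++
    row 1 2 (0 ∷ 1 ∷ 5 ∷ 8 ∷ []) ++
    row 1 3 (4 ∷ 5 ∷ 6 ∷ 8 ∷ []) ++
    row 1 4 (1 ∷ 2 ∷ 6 ∷ 7 ∷ []) ++
    row 1 5 (0 ∷ 1 ∷ 7 ∷ 8 ∷ []) ++
    row 1 6 (1 ∷ 4 ∷ 6 ∷ 8 ∷ []) ++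
    row 1 7 (1 ∷ 2 ∷ 3 ∷ 6 ∷ []) ++
    row 1 8 (0 ∷ 1 ∷ 6 ∷ 8 ∷ []) ++
    row 0 1 (0 ∷ 3 ∷ 5 ∷ 6 ∷ []) ++
    row 3 1 (0 ∷ 1 ∷ 2 ∷ 3 ∷ 4 ∷ 5 ∷ 6 ∷ 7 ∷ 8 ∷ []) ++
    row 6 1 (0 ∷ 1 ∷ 3 ∷ 6 ∷ []) ++
    row 0 6 (1 ∷ []) ++
    row 6 0 (1 ∷ []) ++
    row 6 3 (1 ∷ []) ++
    row 6 6 (1 ∷ [])

  blockers : List UnimodularVector
  blockers = select table

  |kernel| : All (λ m → length (filter (m ⟂?_) canonical) ≡ 12) canonical
  |kernel| = from-yes (All.all? (λ m → length (filter (m ⟂?_) canonical) ℕₚ.≟ 12) canonical)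

  |kernel∩blockers| : All (λ m → 5 ≤ length (filter (m ⟂?_) blockers)) canonical
  |kernel∩blockers| = from-yes (All.all? (λ m → 5 ℕₚ.≤? length (filter (m ⟂?_) blockers)) canonical)

  blockers! : UniqueSetoid.Unique unimodularSetoid blockers
  blockers! = select! table

theorem3p5 : (R : Ring 0ℓ 0ℓ) → R ≡ ℤ₉ ⊎ R ≡ 𝕊₃ →
    let open PHG R in
    (∃[ B ] IsBlockingSet 57 5 B)
    × (∃[ K ] IsProjectiveArc 60 7 K)
    × (∀ B → IsBlockingSet 57 5 B ⇔ IsProjectiveArc 60 7 (∁ B))
-- The two `≡.refl` arguments evaluate the lengths of `canonical` and `blockers` to 57 + 60 and 57;
-- the 12 in `|kernel|` is read as 5 + 7.
theorem3p5 _ (inj₁ ≡.refl) = blocking-set-by-counting ≡.refl |kernel| blockers! ≡.refl |kernel∩blockers|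
  where open ℤ₉-plane
theorem3p5 _ (inj₂ ≡.refl) = blocking-set-by-counting ≡.refl |kernel| blockers! ≡.refl |kernel∩blockers|
  where open 𝕊₃-plane
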